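{- For all integers $m,n\ge 0$, the unary $m$-lighted $n$-shade right rotation digraph is the Hasse diagram of a lattice.
   Context: Write $[k]=\{1,\dots,k\}$. An $m$-lighted $n$-shade is a pair of sequences $S=(s_1,\dots,s_\ell)$ and $(c_1,\dots,c_\ell)$ of the same length $\ell\ge 0$, where each $s_i$ is a (possibly empty) tuple of positive integers, the sum of all entries of all the tuples is $n$, the $c_i$ are pairwise disjoint (possibly empty) subsets of $[m]$ with union $[m]$, and $c_i\neq\varnothing$ whenever $s_i$ is empty. It is read from top to bottom ("below" means larger index); an index $i$ with $c_i\neq\varnothing$ is a cut with labels $c_i$. It is unary if for each $i$, either $s_i$ is empty and $c_i$ is a singleton, or $c_i=\varnothing$ and $s_i$ has exactly one entry (a "singleton tuple"). The right rotation digraph on unary $m$-lighted $n$-shades has an edge from $\mathbb{S}$ to $\mathbb{S}'$ whenever $\mathbb{S}'$ is obtained from $\mathbb{S}$ by one of: (i) replacing a singleton tuple $(r)$ by two consecutive singleton tuples $(s),(t)$ with $r=s+t$, $s\ge1$, $t\ge1$; (ii) exchanging a singleton tuple with a cut immediately below it (so that the cut moves above it); (iii) exchanging the labels of two consecutive cuts with no singleton tuple in between, passing the small label above the large label (in $\mathbb{S}$ the larger label is above the smaller, in $\mathbb{S}'$ the smaller is above the larger). Edges are oriented from the smaller to the larger element of the order. -}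

module Defs where

open import Algebra.Core using (Op₂)
open import Data.Fin.Base as Fin using (Fin)
open import Data.Fin.Subset using (Subset; ⊥; ⊤; _∩_; ⋃; ⁅_⁆; Empty; Nonempty)
open import Data.List.Base using (List; []; _∷_; [_]; map)
open import Data.List.Relation.Unary.All using (All)
open import Data.List.Relation.Unary.AllPairs using (AllPairs)
open import Data.Nat.Base using (ℕ; _+_; _≤_)
open import Data.Nat.ListAction using (sum)
open import Data.Product.Base using (Σ; _×_; _,_; ∃-syntax; proj₁; proj₂)
open import Data.Refinement using (Refinement-syntax; value)
open import Data.Sum.Base using (_⊎_)
open import Function.Base using (_∘_; _on_)
open import Function.Bundles using (_⇔_)
open import Level using (Level; 0ℓ)
open import Relation.Binary.Core using (Rel)
open import Relation.Binary.Lattice.Structures using (IsLattice)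
open import Relation.Binary.PropositionalEquality.Core using (_≡_)
open import Relation.Nullary.Negation.Core using (¬_)
import Relation.Binary.Construct.NonStrictToStrict as ToStrict

private
  variable
    a ℓ ℓ′ : Level
    m : ℕ

-- The label set {1, …, m} is represented by Fin m with its usual order.

-- The pair (sᵢ , cᵢ) at one index i; a shade lists these from top to bottom.
Layer : ℕ → Set
Layer m = List ℕ × Subset m

tuple : Layer m → List ℕ
tuple = proj₁

labels : Layer m → Subset m
labels = proj₂

record IsShade (m n : ℕ) (S : List (Layer m)) : Set where
  field
    positive : All (All (1 ≤_) ∘ tuple) S
    total    : sum (map (sum ∘ tuple) S) ≡ n
    disjoint : AllPairs (λ l l′ → Empty (labels l ∩ labels l′)) S
    covering : ⋃ (map labels S) ≡ ⊤
    nonempty : All (λ l → tuple l ≡ [] → Nonempty (labels l)) S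

-- The side conditions are proof-irrelevant, so that shades are
-- propositionally equal exactly when their sequences are.
Shade : ℕ → ℕ → Set
Shade m n = [ S ∈ List (Layer m) ∣ IsShade m n S ]

cut : Fin m → Layer m
cut i = [] , ⁅ i ⁆

single : ℕ → Layer m
single r = [ r ] , ⊥

IsUnary : List (Layer m) → Set
IsUnary = All λ l → (∃[ i ] l ≡ cut i) ⊎ (∃[ r ] l ≡ single r)

UnaryShade : ℕ → ℕ → Set
UnaryShade m n = [ S ∈ Shade m n ∣ IsUnary (value S) ]

layers : ∀ {m n} → UnaryShade m n → List (Layer m)
layers = value ∘ value

infix 4 _⟶_

data _⟶_ {m : ℕ} : Rel (List (Layer m)) 0ℓ where
  split : ∀ {r s t S} → 1 ≤ s → 1 ≤ t → r ≡ s + t →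
          single r ∷ S ⟶ single s ∷ single t ∷ S
  raise : ∀ {r i S} →
          single r ∷ cut i ∷ S ⟶ cut i ∷ single r ∷ S
  swap  : ∀ {i j S} → i Fin.< j →
          cut j ∷ cut i ∷ S ⟶ cut i ∷ cut j ∷ S
  below : ∀ {l S S′} → S ⟶ S′ → l ∷ S ⟶ l ∷ S′

RightRotation : ∀ m n → Rel (UnaryShade m n) 0ℓ
RightRotation m n = _⟶_ on layers

Covers : {A : Set a} → Rel A ℓ → Rel A ℓ′ → Rel A _
Covers _≈_ _≤_ x y = x < y × ¬ (∃[ z ] x < z × z < y)
  where open ToStrict _≈_ _≤_ using (_<_)

-- An edge x → y of a Hasse diagram means that y covers x.
IsHasseDiagram : {A : Set a} → Rel A ℓ → Rel A ℓ′ → Set _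
IsHasseDiagram _⟶_ _≤_ = ∀ x y → (x ⟶ y) ⇔ Covers _≡_ _≤_ x y

-- For finite A, as here, the order is determined by its covering relation.
IsHasseDiagramOfLattice : {A : Set} → Rel A 0ℓ → Set₁
IsHasseDiagramOfLattice {A} _⟶_ =
  Σ (Rel A 0ℓ) λ _≤_ → Σ (Op₂ A) λ _∨_ → Σ (Op₂ A) λ _∧_ →
    IsLattice _≡_ _≤_ _∨_ _∧_ × IsHasseDiagram _⟶_ _≤_

{-# OPTIONS --safe #-}

-- Write a shade as a word of lights and blocks.  Going up in the order, some
-- letters can be pulled to the front of a word; x ⊑ y holds when the letters of
-- y can be pulled out of x one after the other.  Dually, l ∷ w ⊑ x is governed
-- by pushing l out of x.  The join of x and y starts with the greatest letter
-- that can be pulled out of both and continues with the join of the remainders: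
-- pulling a further common letter c out of x and y pulls it out of the join as
-- well, leaving the join of what is left, so the join lies below every upper
-- bound by induction on that bound.  The meet starts with the least letter that
-- can be pushed out of both.

module Submission where

open import Defs
open import Algebra.Core using (Op₂)
import Data.Bool.Properties as Bool
open import Data.Empty using (⊥-elim)
open import Data.Fin.Base using (Fin; toℕ)
open import Data.Fin.Properties as Fin using (toℕ-injective; toℕ<n)
open import Data.Fin.Subset as Subset using (Subset; ⊥; _∩_; ⋃; ⁅_⁆; Empty)
open import Data.Fin.Subset.Properties
  using (nonempty?; x∈⁅x⁆; x∈⁅y⁆⇒x≡y; ∉⊥; ∈⊤; ⊆⊤; ⊆-antisym; x∈p∪q⁺; x∈p∪q⁻; x∈p∩q⁺; x∈p∩q⁻)
open import Data.Irrelevant using ([_])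
open import Data.List.Base
  using (List; []; _∷_; length; map; _++_; filter; allFin; upTo; concatMap)
open import Data.List.Extrema.Nat
  using (argmin; argmax; argmin-all; argmax-all; f[argmin]≤f[⊤]; f[argmin]≤f[xs]; f[⊥]≤f[argmax]; f[xs]≤f[argmax])
open import Data.List.Membership.DecPropositional using (_∈?_)
open import Data.List.Membership.Propositional using (_∈_)
open import Data.List.Membership.Propositional.Properties
  using (∈-filter⁺; ∈-map⁺; ∈-++⁺ˡ; ∈-++⁺ʳ; ∈-allFin; ∈-upTo⁺)
open import Data.List.Membership.Propositional.Properties.WithK using (unique∧set⇒bag)
open import Data.List.Properties as List using (∷-injectiveˡ; ∷-injectiveʳ)
open import Data.List.Relation.Binary.BagAndSetEquality using (∼bag⇒↭)
open import Data.List.Relation.Binary.Permutation.Propositional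
  using (_↭_; ↭-refl; ↭-sym; ↭-trans; ↭⇒↭ₛ; prep; swap)
open import Data.List.Relation.Binary.Permutation.Propositional.Properties
  using (↭-length; drop-∷; All-resp-↭; ∈-resp-↭; ↭-empty-inv)
import Data.List.Relation.Binary.Permutation.Setoid.Properties as ↭ₛ
open import Data.List.Relation.Unary.All as All using (All; []; _∷_)
open import Data.List.Relation.Unary.All.Properties using (all-filter; map⁺)
open import Data.List.Relation.Unary.AllPairs using (AllPairs; []; _∷_)
open import Data.List.Relation.Unary.Any using (here; there)
open import Data.List.Relation.Unary.Unique.DecPropositional using (unique?)
open import Data.List.Relation.Unary.Unique.Propositional using (Unique)
open import Data.Nat.Base using (ℕ; zero; suc; _+_; _≤_; _<_; s≤s; z<s)
open import Data.Nat.Induction using (Acc; acc; <-wellFounded)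
open import Data.Nat.ListAction using (sum)
open import Data.Nat.Properties
open import Data.Product.Base using (_×_; _,_; ∃; ∃-syntax; proj₁; proj₂; map₂)
import Data.Product.Properties as Product
open import Data.Refinement using (_,_; value-injective)
open import Data.Sum.Base using (_⊎_; inj₁; inj₂)
import Data.Vec.Properties as Vec
open import Function.Base using (_∘_; case_of_)
open import Function.Bundles using (mk⇔)
open import Relation.Binary.Core using (Rel)
open import Relation.Binary.Definitions using (tri<; tri≈; tri>)
open import Relation.Binary.Lattice.Structures using (IsLattice)
open import Relation.Binary.PropositionalEquality
open import Relation.Nullary.Decidable using (Dec; yes; no; map′; _×-dec_; recompute)
open import Relation.Nullary.Negation using (¬_; contradiction)

-- Letters, words and the order on letters.

private
  variable
    m n r s t : ℕ

-- block r stands for the singleton tuple (suc r), so that positivity is automatic.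
data Letter (m : ℕ) : Set where
  light : Fin m → Letter m
  block : ℕ → Letter m

Word : ℕ → Set
Word m = List (Letter m)

-- Lights are ordered by label and precede all blocks: a rotation other than a
-- split moves the smaller of two adjacent letters up.
key : Letter m → ℕ
key         (light i) = toℕ i
key {m = m} (block r) = m + r

private
  variable
    i j : Fin m
    c d k l : Letter m
    x x′ x₁ x₂ y y′ y₁ z w : Word m

infix 4 _≺_ _⊑_ _⇝_ _~_

_≺_ : Letter m → Letter m → Set
k ≺ l = key k < key l

light≺block : light i ≺ block r
light≺block {i = i} = m≤n⇒m≤n+o _ (toℕ<n i)

block⊀light : ¬ block r ≺ light i
block⊀light {r = r} {i = i} = <-asym (light≺block {i = i} {r = r})

block≺block⇒< : block {m = m} s ≺ block r → s < r
block≺block⇒< {m = m} = +-cancelˡ-< m _ _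

key-injective : key k ≡ key l → k ≡ l
key-injective {k = light i} {l = light j} eq = cong light (toℕ-injective eq)
key-injective {k = block r} {l = block s} eq = cong block (+-cancelˡ-≡ _ r s eq)
key-injective {k = light i} {l = block s} eq = ⊥-elim (<-irrefl eq (light≺block {i = i} {r = s}))
key-injective {k = block r} {l = light j} eq = ⊥-elim (<-irrefl (sym eq) (light≺block {i = j} {r = r}))

-- The order on words

-- Pull l x x′: among the words above x that start with l there is a least one, l ∷ x′.
data Pull {m : ℕ} : Letter m → Word m → Word m → Set where
  here : Pull l (l ∷ x) x
  part : r ≡ suc (s + t) → Pull (block s) (block r ∷ x) (block t ∷ x)
  past : light i ≺ l → Pull (light i) x x′ → Pull (light i) (l ∷ x) (l ∷ x′)

data _⊑_ {m : ℕ} : Word m → Word m → Set where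
  []  : [] ⊑ []
  _∷_ : Pull l x x′ → x′ ⊑ y → x ⊑ l ∷ y

⊑-refl : x ⊑ x
⊑-refl {x = []}    = []
⊑-refl {x = l ∷ x} = here ∷ ⊑-refl

part-unique : ∀ {u} → r ≡ suc (s + t) → r ≡ suc (s + u) → t ≡ u
part-unique refl eq = +-cancelˡ-≡ _ _ _ (suc-injective eq)

part-irrefl : ¬ r ≡ suc (r + t)
part-irrefl eq = <-irrefl eq (s≤s (m≤m+n _ _))

part-assoc : ∀ s {t u} → suc (s + t) + u ≡ s + suc (t + u)
part-assoc s = trans (cong suc (+-assoc s _ _)) (sym (+-suc s _))

Pull-functional : Pull l x x₁ → Pull l x x₂ → x₁ ≡ x₂
Pull-functional here          here          = refl
Pull-functional here          (part eq)     = contradiction eq part-irrefl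
Pull-functional here          (past l≺l _)  = contradiction l≺l (<-irrefl refl)
Pull-functional (part eq)     here          = contradiction eq part-irrefl
Pull-functional (part eq)     (part eq′)    = cong (λ t → block t ∷ _) (part-unique eq eq′)
Pull-functional (past l≺l _)  here          = contradiction l≺l (<-irrefl refl)
Pull-functional (past _ p)    (past _ q)    = cong (_ ∷_) (Pull-functional p q)

∷-cancel-⊑ : l ∷ x ⊑ l ∷ y → x ⊑ y
∷-cancel-⊑ (p ∷ x⊑y) rewrite Pull-functional p here = x⊑y

-- A block is only ever pulled from the front block of a word, so it may be taken out in two pieces.
Pull-split : r ≡ suc (s + t) → Pull (block r) x x′ →
             ∃[ w ] Pull (block s) x w × Pull (block t) w x′
Pull-split eq here = _ , part eq , here
Pull-split {s = s} {t} refl (part {t = u} refl) =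
  _ , part (cong suc (part-assoc s)) , part refl

Pull-past : light i ≺ l → Pull l x x₁ → Pull (light i) x₁ x₂ →
            ∃[ w ] Pull (light i) x w × Pull l w x₂
Pull-past i≺l here         q            = _ , past i≺l q , here
Pull-past i≺l (part eq)    (past i≺t q) = _ , past light≺block q , part eq
Pull-past i≺l (past l≺k p) here         = contradiction i≺l (<-asym l≺k)
Pull-past i≺l (past l≺k p) (past i≺k q) =
  let _ , q′ , p′ = Pull-past i≺l p q in _ , past i≺k q′ , past l≺k p′

-- Splitting or passing the first letter of `y` can be carried out in `x` itself, by `Pull-split`
-- and `Pull-past`. Applied to one letter after the other, this gives transitivity.
Pull-⊑ : x ⊑ y → Pull l y y′ → ∃[ x′ ] Pull l x x′ × x′ ⊑ y′
Pull-⊑ (p ∷ x⊑y) here          = _ , p , x⊑y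
Pull-⊑ (p ∷ x⊑y) (part eq)     =
  let _ , p₁ , p₂ = Pull-split eq p in _ , p₁ , p₂ ∷ x⊑y
Pull-⊑ (p ∷ x⊑y) (past i≺k q)  =
  let _ , q₁ , x₁⊑y₁ = Pull-⊑ x⊑y q
      _ , q₂ , p′    = Pull-past i≺k p q₁
  in _ , q₂ , p′ ∷ x₁⊑y₁

⊑-trans : x ⊑ y → y ⊑ z → x ⊑ z
⊑-trans []  []        = []
⊑-trans x⊑y (p ∷ y⊑z) = let _ , q , x′⊑y′ = Pull-⊑ x⊑y p in q ∷ ⊑-trans x′⊑y′ y⊑z

block-⊑⇒≤ : block r ∷ x ⊑ block s ∷ y → s ≤ r
block-⊑⇒≤ (here ∷ _)      = ≤-refl
block-⊑⇒≤ (part refl ∷ _) = m≤n⇒m≤1+n (m≤m+n _ _)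

-- Going up never increases the key of the first letter: it stays, is cut to a shorter block, or is
-- passed by a smaller light. The tails are therefore irrelevant.
heads-≡ : k ∷ x ⊑ l ∷ y → l ∷ x₁ ⊑ k ∷ y₁ → k ≡ l
heads-≡ (here ∷ _)         _                  = refl
heads-≡ (part _ ∷ _)       (here ∷ _)         = refl
heads-≡ x⊑y@(part _ ∷ _)   y⊑x@(part _ ∷ _)   = cong block (≤-antisym (block-⊑⇒≤ y⊑x) (block-⊑⇒≤ x⊑y))
heads-≡ (past l≺k _ ∷ _)   (here ∷ _)         = refl
heads-≡ (past l≺k _ ∷ _)   (past k≺l _ ∷ _)   = contradiction l≺k (<-asym k≺l)

⊑-antisym : x ⊑ y → y ⊑ x → x ≡ y
⊑-antisym []                   []  = refl
⊑-antisym {x = l ∷ _} x⊑y@(_ ∷ _) y⊑x@(_ ∷ _) with refl ← heads-≡ x⊑y y⊑x =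
  cong (l ∷_) (⊑-antisym (∷-cancel-⊑ x⊑y) (∷-cancel-⊑ y⊑x))

-- Push l x x′: among the words below x that start with l there is a greatest one, l ∷ x′.
data Push {m : ℕ} : Letter m → Word m → Word m → Set where
  here : Push l (l ∷ x) x
  join : r ≡ suc (s + t) → Push (block t) x x′ → Push (block r) (block s ∷ x) x′
  past : light i ≺ l → Push l x x′ → Push l (light i ∷ x) (light i ∷ x′)

Push⇒⊑ : Push l x x′ → l ∷ x′ ⊑ x
Push⇒⊑ here         = ⊑-refl
Push⇒⊑ (join eq p)  = part eq ∷ Push⇒⊑ p
Push⇒⊑ (past i≺l p) = past i≺l here ∷ Push⇒⊑ p

-- With `Push⇒⊑` this is the universal property of pushing. Each letter of `x` pulled from `l ∷ y`
-- before `l` is used up either passes `l` or is cut from it; these are the constructors `past` and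
-- `join`.
⊑⇒Push : l ∷ y ⊑ x → ∃[ x′ ] Push l x x′ × y ⊑ x′
⊑⇒Push (here ∷ y⊑x)       = _ , here , y⊑x
⊑⇒Push (part eq ∷ y⊑x)    = let _ , p , y⊑x′ = ⊑⇒Push y⊑x in _ , join eq p , y⊑x′
⊑⇒Push (past i≺l q ∷ y⊑x) = let _ , p , y⊑x′ = ⊑⇒Push y⊑x in _ , past i≺l p , q ∷ y⊑x′

Push-functional : Push l x x₁ → Push l x x₂ → x₁ ≡ x₂
Push-functional here          here          = refl
Push-functional here          (join eq _)   = contradiction eq part-irrefl
Push-functional here          (past l≺l _)  = contradiction l≺l (<-irrefl refl)
Push-functional (join eq _)   here          = contradiction eq part-irrefl
Push-functional (join {t = t} eq p) (join {t = u} eq′ q)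
  with refl ← part-unique {t = t} {u = u} eq eq′ = Push-functional p q
Push-functional (past l≺l _)  here          = contradiction l≺l (<-irrefl refl)
Push-functional (past _ p)    (past _ q)    = cong (_ ∷_) (Push-functional p q)

-- Joins and meets of words

-- A relation rather than a function: the order properties only use the maximality of the chosen
-- letter, while search and termination are left to `∃-Join`.
data Join {m : ℕ} : Word m → Word m → Word m → Set where
  []   : Join [] [] []
  cons : Pull l x x′ → Pull l y y′ →
         (∀ {c v w} → Pull c x v → Pull c y w → key c ≤ key l) →
         Join x′ y′ z → Join x y (l ∷ z)

Join⇒⊑ˡ : Join x y z → x ⊑ z
Join⇒⊑ˡ []             = []
Join⇒⊑ˡ (cons p _ _ J) = p ∷ Join⇒⊑ˡ J

Join⇒⊑ʳ : Join x y z → y ⊑ z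
Join⇒⊑ʳ []             = []
Join⇒⊑ʳ (cons _ q _ J) = q ∷ Join⇒⊑ʳ J

-- A pulled letter passes only larger ones, so `l` cannot pass `light i`. Hence the light lies below
-- the place from which `l` is taken, and the two pulls commute.
Pull-exchange : light i ≺ l → Pull l x x₁ → Pull (light i) x x₂ →
                ∃[ w ] Pull (light i) x₁ w × Pull l x₂ w
Pull-exchange i≺l here         here         = contradiction i≺l (<-irrefl refl)
Pull-exchange i≺l here         (past _ q)   = _ , q , here
Pull-exchange i≺l (part eq)    (past _ q)   = _ , past light≺block q , part eq
Pull-exchange i≺l (past l≺k p) here         = contradiction i≺l (<-asym l≺k)
Pull-exchange i≺l (past l≺k p) (past i≺k q) =
  let _ , q′ , p′ = Pull-exchange i≺l p q in _ , past i≺k q′ , past l≺k p′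

-- Hence l stays the greatest letter that two words have in common after the
-- smaller light i has been pulled out of both.
Pull-above : light i ≺ l → l ≺ d → Pull l x x₁ → Pull (light i) x x₂ →
             Pull d x₂ y → ∃ (Pull d x)
Pull-above i≺l l≺d here         here         _            = contradiction i≺l (<-irrefl refl)
Pull-above i≺l l≺d (past l≺k p) here         _            = contradiction i≺l (<-asym l≺k)
Pull-above i≺l l≺d p            (past i≺k q) here         = _ , here
Pull-above i≺l l≺d p            (past i≺k q) (part eq)    = _ , part eq
Pull-above i≺l l≺d here         (past i≺k q) (past d≺k _) = contradiction l≺d (<-asym d≺k)
Pull-above i≺l l≺d (part _)     (past i≺k q) (past {i = j} d≺k _) = contradiction l≺d (block⊀light {i = j})
Pull-above i≺l l≺d (past _ p)   (past i≺k q) (past d≺k e) = _ , past d≺k (proj₂ (Pull-above i≺l l≺d p q e))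

Pull-difference : r ≡ suc (s + t) → Pull (block r) x x₁ → Pull (block s) x x₂ → Pull (block t) x₂ x₁
Pull-difference eq here       here       = contradiction eq part-irrefl
Pull-difference {t = t} eq here (part {t = u} eq′)
  with refl ← part-unique {t = t} {u = u} eq eq′ = here
Pull-difference {s = s} refl (part eq) here =
  contradiction (trans eq (cong suc (part-assoc s))) part-irrefl
Pull-difference {s = s} refl (part eq) (part eq′) =
  part (part-unique eq′ (trans eq (cong suc (part-assoc s))))

<⇒part : s < r → ∃[ t ] r ≡ suc (s + t)
<⇒part s<r = map₂ sym (m≤n⇒∃[o]m+o≡n s<r)

-- Since the longer `block r` also comes out of `x`, `block s` is not the whole front block, and
-- `block t` is taken from the remainder of that same block.
Pull-part-trans : s < r → Pull (block r) x x₁ → Pull (block s) x x₂ → Pull (block t) x₂ y →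
                  ∃ (Pull (block (suc (s + t))) x)
Pull-part-trans s<r here      here       _    = contradiction refl (<⇒≢ s<r)
Pull-part-trans s<r (part eq) here       _    =
  contradiction (≤-trans (s≤s (m≤m+n _ _)) (≤-reflexive (sym eq))) (<⇒≯ s<r)
Pull-part-trans s<r p         (part refl) here = _ , here
Pull-part-trans {s = s} s<r p (part eq)  (part refl) =
  _ , part (trans eq (cong suc (sym (part-assoc s))))

compare-≼ : ∀ (k l : Letter m) → key k ≤ key l → k ≡ l ⊎ k ≺ l
compare-≼ k l k≼l with m≤n⇒m<n∨m≡n k≼l
... | inj₁ k≺l = inj₂ k≺l
... | inj₂ k≡l = inj₁ (key-injective k≡l)

-- By maximality `c` is at most the first letter `l` of the join. A smaller light commutes with `l`
-- and exposes no common letter above `l`. A smaller block is an initial part of the block `l`,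
-- whose remainder then heads the new join.
Join-Pull : Join x y z → Pull c x x₁ → Pull c y y₁ → ∃[ w ] Pull c z w × Join x₁ y₁ w
Join-Pull {c = c} (cons {l = l} p q l-max J) p′ q′ with compare-≼ c l (l-max p′ q′)
... | inj₁ refl with refl ← Pull-functional p p′ | refl ← Pull-functional q q′ = _ , here , J
Join-Pull {c = light i} (cons {l = l} p q l-max J) p′ q′ | inj₂ i≺l =
  let _ , p₁ , p₂ = Pull-exchange i≺l p p′
      _ , q₁ , q₂ = Pull-exchange i≺l q q′
      _ , e , J′  = Join-Pull J p₁ q₁
  in _ , past i≺l e , cons p₂ q₂
       (λ a b → ≮⇒≥ λ l≺d → <⇒≱ l≺d
         (l-max (proj₂ (Pull-above i≺l l≺d p p′ a)) (proj₂ (Pull-above i≺l l≺d q q′ b))))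
       J′
Join-Pull {c = block s} (cons {l = light i} _ _ _ _) _ _ | inj₂ s≺i = contradiction s≺i (block⊀light {i = i})
Join-Pull {m} {c = block s} (cons {l = block r} p q l-max J) p′ q′ | inj₂ s≺r
  with s<r ← block≺block⇒< {m} s≺r
  with t , refl ← <⇒part s<r =
  _ , part refl , cons (Pull-difference refl p p′) (Pull-difference refl q q′) t-max J
  where
  -- A common block longer than `block t`, put together with `block s`, would be a common block of
  -- `x` and `y` longer than `block r`.
  t-max : ∀ {c v w} → Pull c _ v → Pull c _ w → key c ≤ key (block t)
  t-max {light i} _ _ = <⇒≤ (light≺block {i = i} {r = t})
  t-max {block u} a b = +-monoʳ-≤ m (+-cancelˡ-≤ (suc s) u t (+-cancelˡ-≤ m _ _
    (l-max (proj₂ (Pull-part-trans s<r p p′ a)) (proj₂ (Pull-part-trans s<r q q′ b)))))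

Join-least : Join x y z → x ⊑ w → y ⊑ w → z ⊑ w
Join-least []             []        []        = []
Join-least (cons () _ _ _) []       []
Join-least J              (p ∷ x⊑w) (q ∷ y⊑w) =
  let _ , e , J′ = Join-Pull J p q in e ∷ Join-least J′ x⊑w y⊑w

-- Meets, by pushing.

data Meet {m : ℕ} : Word m → Word m → Word m → Set where
  []   : Meet [] [] []
  cons : Push l x x′ → Push l y y′ →
         (∀ {c v w} → Push c x v → Push c y w → key l ≤ key c) →
         Meet x′ y′ z → Meet x y (l ∷ z)

∷-mono-⊑ : x ⊑ y → l ∷ x ⊑ l ∷ y
∷-mono-⊑ x⊑y = here ∷ x⊑y

Meet⇒⊑ˡ : Meet x y z → z ⊑ x
Meet⇒⊑ˡ []             = []
Meet⇒⊑ˡ (cons p _ _ M) = ⊑-trans (∷-mono-⊑ (Meet⇒⊑ˡ M)) (Push⇒⊑ p)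

Meet⇒⊑ʳ : Meet x y z → z ⊑ y
Meet⇒⊑ʳ []             = []
Meet⇒⊑ʳ (cons _ q _ M) = ⊑-trans (∷-mono-⊑ (Meet⇒⊑ʳ M)) (Push⇒⊑ q)

Push-exchange : light i ≺ l → Push (light i) x x₁ → Push l x x₂ →
                ∃[ w ] Push l x₁ w × Push (light i) x₂ w
Push-exchange i≺l here         here         = contradiction i≺l (<-irrefl refl)
Push-exchange i≺l here         (past _ q)   = _ , q , here
Push-exchange i≺l (past k≺i p) here         = contradiction i≺l (<-asym k≺i)
Push-exchange i≺l (past k≺i p) (past k≺l q) =
  let _ , q′ , p′ = Push-exchange i≺l p q in _ , past k≺l q′ , past k≺i p′

-- The counterpart of `Pull-above`: `light i` stays the least common letter after a greater one has
-- been pushed out of both words.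
Push-below : light i ≺ l → d ≺ light i → Push (light i) x x₁ → Push l x x₂ →
             Push d x₂ y → ∃ (Push d x)
Push-below i≺l d≺i here         here         _            = contradiction i≺l (<-irrefl refl)
Push-below i≺l d≺i (past k≺i p) here         _            = contradiction i≺l (<-asym k≺i)
Push-below i≺l d≺i here         (past _ q)   here         = contradiction d≺i (<-irrefl refl)
Push-below i≺l d≺i here         (past _ q)   (past i≺d _) = contradiction i≺d (<-asym d≺i)
Push-below i≺l d≺i (past k≺i p) (past _ q)   here         = _ , here
Push-below i≺l d≺i (past k≺i p) (past _ q)   (past k≺d e) = _ , past k≺d (proj₂ (Push-below i≺l d≺i p q e))

-- Pushing out a block merges the first few blocks of the word and leaves the lights between them
-- behind. The blocks merged for `block r` begin with those merged for `block s`; the others make up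
-- `block t`.
Push-difference : r ≡ suc (s + t) → Push (block s) x x₁ → Push (block r) x x₂ → Push (block t) x₁ x₂
Push-difference eq here       here       = contradiction eq part-irrefl
Push-difference {t = t} eq here (join {t = u} eq′ q)
  with refl ← part-unique {t = t} {u = u} eq eq′ = q
Push-difference {s = s} refl (join eq p) here =
  contradiction (trans eq (cong suc (part-assoc s))) part-irrefl
Push-difference refl (join {s = k} refl p) (join eq q) =
  Push-difference (part-unique eq (cong suc (part-assoc k))) p q
Push-difference eq (past _ p) (past _ q) = past light≺block (Push-difference eq p q)

-- By minimality the first letter `l` of the meet is at most `c`. If `l` is a smaller light, the two
-- pushes commute. If it is a shorter block, `c` is a block too, and the excess of `c` over `l` is
-- pushed out of the rest of the meet by induction.
Meet-Push : Meet x y z → Push c x x₁ → Push c y y₁ → ∃[ w ] Push c z w × Meet x₁ y₁ w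
Meet-Push {c = c} (cons {l = l} p q l-min M) p′ q′ with compare-≼ l c (l-min p′ q′)
... | inj₁ refl with refl ← Push-functional p p′ | refl ← Push-functional q q′ = _ , here , M
Meet-Push (cons {l = light i} p q l-min M) p′ q′ | inj₂ i≺c =
  let _ , p₁ , p₂ = Push-exchange i≺c p p′
      _ , q₁ , q₂ = Push-exchange i≺c q q′
      _ , e , M′  = Meet-Push M p₁ q₁
  in _ , past i≺c e , cons p₂ q₂
       (λ a b → ≮⇒≥ λ d≺i → <⇒≱ d≺i
         (l-min (proj₂ (Push-below i≺c d≺i p p′ a)) (proj₂ (Push-below i≺c d≺i q q′ b))))
       M′
Meet-Push {c = light i} (cons {l = block s} _ _ _ _) _ _ | inj₂ s≺i = contradiction s≺i (block⊀light {i = i})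
Meet-Push {m} {c = block s} (cons {l = block r} p q l-min M) p′ q′ | inj₂ r≺s
  with t , refl ← <⇒part (block≺block⇒< {m} r≺s) =
  let _ , e , M′ = Meet-Push M (Push-difference refl p p′) (Push-difference refl q q′)
  in _ , join refl e , M′

Meet-greatest : Meet x y z → w ⊑ x → w ⊑ y → w ⊑ z
Meet-greatest {w = []}    []              []  []  = []
Meet-greatest {w = []}    (cons () _ _ _) []  []
Meet-greatest {w = l ∷ w} M               w⊑x w⊑y =
  let _ , p , w⊑x′ = ⊑⇒Push w⊑x
      _ , q , w⊑y′ = ⊑⇒Push w⊑y
      _ , e , M′   = Meet-Push M p q
  in ⊑-trans (∷-mono-⊑ (Meet-greatest M′ w⊑x′ w⊑y′)) (Push⇒⊑ e)

-- Covering relations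

-- lift covers both the exchange of two cuts and that of a tuple with a cut.
data _⇝_ {m : ℕ} : Word m → Word m → Set where
  split : r ≡ suc (s + t) → block r ∷ x ⇝ block s ∷ block t ∷ x
  lift  : light i ≺ l → l ∷ light i ∷ x ⇝ light i ∷ l ∷ x
  below : x ⇝ y → l ∷ x ⇝ l ∷ y

⇝⇒⊑ : x ⇝ y → x ⊑ y
⇝⇒⊑ (split eq)  = part eq ∷ ⊑-refl
⇝⇒⊑ (lift i≺l)  = past i≺l here ∷ ⊑-refl
⇝⇒⊑ (below x⇝y) = here ∷ ⇝⇒⊑ x⇝y

⇝-irrefl : ¬ x ⇝ x
⇝-irrefl (lift i≺i)  = <-irrefl refl i≺i
⇝-irrefl (below x⇝x) = ⇝-irrefl x⇝x

-- The first letter of `z` must be that of `x` or that of `y`. Cancelling it leaves tails that agree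
-- by antisymmetry, or the same question about the tails.
⇝-between : x ⇝ y → x ⊑ z → z ⊑ y → z ≡ x ⊎ z ≡ y
⇝-between (split eq) (p ∷ x⊑z) (here ∷ z⊑y)
  with refl ← Pull-functional p (part eq) = inj₂ (cong (_ ∷_) (⊑-antisym z⊑y x⊑z))
⇝-between (split {t = t} eq) (here ∷ x⊑z) (part {t = u} eq′ ∷ z⊑y)
  with refl ← part-unique {t = t} {u = u} eq eq′ = inj₁ (cong (_ ∷_) (⊑-antisym (∷-cancel-⊑ z⊑y) x⊑z))
-- The first block of `z` would be a proper part of `block r`, yet cutting `block s` from it would
-- leave a block at least as long as `block t`.
⇝-between (split eq) x⊑z@(part {t = u} eq″ ∷ _) (part {s = s} eq′ ∷ z⊑y) =
  contradiction (≤-trans (≤-reflexive eq) (≤-trans (s≤s (+-monoʳ-≤ s (block-⊑⇒≤ z⊑y))) (≤-reflexive (sym eq′))))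
    (<⇒≱ (≤-trans (s≤s (m≤m+n _ u)) (≤-reflexive (sym eq″))))
⇝-between (lift i≺l) (p ∷ x⊑z) (here ∷ z⊑y)
  with refl ← Pull-functional p (past i≺l here) = inj₂ (cong (_ ∷_) (⊑-antisym z⊑y x⊑z))
⇝-between {z = l ∷ _} (lift i≺l) x⊑z (past _ q ∷ z⊑y)
  with refl ← heads-≡ x⊑z z⊑y =
  inj₁ (cong (l ∷_) (⊑-antisym (q ∷ ∷-cancel-⊑ z⊑y) (∷-cancel-⊑ x⊑z)))
⇝-between {z = l ∷ _} (below x⇝y) x⊑z z⊑y
  with refl ← heads-≡ x⊑z z⊑y with ⇝-between x⇝y (∷-cancel-⊑ x⊑z) (∷-cancel-⊑ z⊑y)
... | inj₁ refl = inj₁ refl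
... | inj₂ refl = inj₂ refl

-- The first step exchanges the light with the letter directly above it, however deep in the word.
Pull⇒⇝ : Pull (light i) x x′ → x ≡ light i ∷ x′ ⊎ ∃[ z ] x ⇝ z × Pull (light i) z x′
Pull⇒⇝ here = inj₁ refl
Pull⇒⇝ (past i≺l p) with Pull⇒⇝ p
... | inj₁ refl            = inj₂ (_ , lift i≺l , here)
... | inj₂ (_ , x⇝z , q) = inj₂ (_ , below x⇝z , past i≺l q)

⊑⇒⇝ : x ⊑ y → x ≡ y ⊎ ∃[ z ] x ⇝ z × z ⊑ y
⊑⇒⇝ [] = inj₁ refl
⊑⇒⇝ (here ∷ x⊑y) with ⊑⇒⇝ x⊑y
... | inj₁ refl            = inj₁ refl
... | inj₂ (_ , x⇝z , z⊑y) = inj₂ (_ , below x⇝z , here ∷ z⊑y)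
⊑⇒⇝ (part eq ∷ x⊑y) = inj₂ (_ , split eq , here ∷ x⊑y)
⊑⇒⇝ (past {l = l} i≺l p ∷ x⊑y) with Pull⇒⇝ (past {l = l} i≺l p)
... | inj₁ refl            = contradiction i≺l (<-irrefl refl)
... | inj₂ (_ , x⇝z , q) = inj₂ (_ , x⇝z , q ∷ x⊑y)

-- Existence of joins and meets

total : Word m → ℕ
total []            = 0
total (light _ ∷ x) = total x
total (block r ∷ x) = suc (r + total x)

lights : Word m → List (Fin m)
lights []            = []
lights (light i ∷ x) = i ∷ lights x
lights (block _ ∷ x) = lights x

-- The invariants of the rotations: comparable words agree in both, and any two words that agree
-- have a join and a meet.
record _~_ (x y : Word m) : Set where
  constructor _,_
  field
    total-≡  : total x ≡ total y
    lights-↭ : lights x ↭ lights y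

open _~_

~-sym : x ~ y → y ~ x
~-sym (eq , σ) = sym eq , ↭-sym σ

~-trans : x ~ y → y ~ z → x ~ z
~-trans (eq , σ) (eq′ , σ′) = trans eq eq′ , ↭-trans σ σ′

∷-mono-~ : x ~ y → l ∷ x ~ l ∷ y
∷-mono-~ {l = light i} (eq , σ) = eq , prep i σ
∷-mono-~ {l = block r} (eq , σ) = cong (suc ∘ (r +_)) eq , σ

∷-cancel-~ : l ∷ x ~ l ∷ y → x ~ y
∷-cancel-~ {l = light i} (eq , σ) = eq , drop-∷ σ
∷-cancel-~ {l = block r} (eq , σ) = +-cancelˡ-≡ (suc r) _ _ eq , σ

light-∷-comm-~ : l ∷ light i ∷ x ~ light i ∷ l ∷ x
light-∷-comm-~ {l = light j} = refl , swap j _ ↭-refl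
light-∷-comm-~ {l = block r} = refl , ↭-refl

Pull⇒~ : Pull l x x′ → x ~ l ∷ x′
Pull⇒~ here                       = refl , ↭-refl
Pull⇒~ (part {s = s} {t} refl)    = cong suc (part-assoc s) , ↭-refl
Pull⇒~ (past {x′ = x′} _ p) = ~-trans (∷-mono-~ (Pull⇒~ p)) (light-∷-comm-~ {x = x′})

⊑⇒~ : x ⊑ y → x ~ y
⊑⇒~ []        = refl , ↭-refl
⊑⇒~ (p ∷ x⊑y) = ~-trans (Pull⇒~ p) (∷-mono-~ (⊑⇒~ x⊑y))

⇝⇒~ : x ⇝ y → x ~ y
⇝⇒~ x⇝y = ⊑⇒~ (⇝⇒⊑ x⇝y)

-- Decidability of pulling and pushing, and search for extreme letters.

pull? : ∀ (l : Letter m) x → Dec (∃ (Pull l x))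
pull? l         []            = no λ ()
pull? (light i) (l ∷ x)       with <-cmp (toℕ i) (key l)
... | tri< i≺l _ _ = map′ (λ (_ , p) → _ , past i≺l p)
                          (λ { (_ , here) → contradiction i≺l (<-irrefl refl) ; (_ , past _ p) → _ , p })
                          (pull? (light i) x)
... | tri≈ _ i≡l _ with refl ← key-injective {k = light i} {l = l} i≡l = yes (_ , here)
... | tri> _ i≢l l≺i = no λ { (_ , here) → i≢l refl ; (_ , past i≺l _) → <-asym i≺l l≺i }
pull? (block s) (light i ∷ x) = no λ ()
pull? (block s) (block r ∷ x) with <-cmp s r
... | tri< s<r _ _  = yes (_ , part (proj₂ (<⇒part s<r)))
... | tri≈ _ refl _ = yes (_ , here)
... | tri> s≮r s≢r _ = no λ { (_ , here) → s≢r refl ; (_ , part refl) → s≮r (s≤s (m≤m+n _ _)) }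

push? : ∀ (l : Letter m) x → Dec (∃ (Push l x))
push? l         []            = no λ ()
push? l         (light i ∷ x) with <-cmp (toℕ i) (key l)
... | tri< i≺l _ _ = map′ (λ (_ , p) → _ , past i≺l p)
                          (λ { (_ , here) → contradiction i≺l (<-irrefl refl) ; (_ , past _ p) → _ , p })
                          (push? l x)
... | tri≈ _ i≡l _ with refl ← key-injective {k = light i} {l = l} i≡l = yes (_ , here)
... | tri> _ i≢l l≺i = no λ { (_ , here) → i≢l refl ; (_ , past i≺l _) → <-asym i≺l l≺i }
push? (light i) (block r ∷ x) = no λ ()
push? (block s) (block r ∷ x) with <-cmp r s
... | tri≈ _ refl _ = yes (_ , here)
... | tri> r≮s r≢s _ = no λ { (_ , here) → r≢s refl ; (_ , join refl _) → r≮s (s≤s (m≤m+n _ _)) }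
... | tri< r<s r≢s _ with t , eq ← <⇒part r<s =
  map′ (λ (_ , p) → _ , join eq p)
       (λ { (_ , here) → contradiction refl r≢s
          ; (_ , join {t = u} eq′ p) → _ , subst (λ t → Push (block t) _ _) (part-unique eq′ eq) p })
       (push? (block t) x)

-- The bound on blocks leaves only finitely many letters to search.
module _ (P : Letter m → Set) (P? : ∀ l → Dec (P l)) {n} (P⇒< : ∀ {r} → P (block r) → r < n) where

  private
    letters candidates : List (Letter m)
    letters    = map light (allFin m) ++ map block (upTo n)
    candidates = filter P? letters

    ∈-candidates : P l → l ∈ candidates
    ∈-candidates {l = light i} pl = ∈-filter⁺ P? (∈-++⁺ˡ (∈-map⁺ light (∈-allFin i))) pl
    ∈-candidates {l = block r} pl = ∈-filter⁺ P? (∈-++⁺ʳ (map light (allFin m)) (∈-map⁺ block (∈-upTo⁺ (P⇒< pl)))) pl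

  ∃-greatest : P c → ∃[ l ] P l × (∀ {d} → P d → key d ≤ key l)
  ∃-greatest {c = c} pc =
    -- The default `c` satisfies `P`, so the maximum does in every case.
    argmax key c candidates ,
    argmax-all key pc (all-filter P? letters) ,
    λ pd → All.lookup (f[xs]≤f[argmax] c candidates) (∈-candidates pd)

  ∃-least : P c → ∃[ l ] P l × (∀ {d} → P d → key l ≤ key d)
  ∃-least {c = c} pc =
    argmin key c candidates ,
    argmin-all key pc (all-filter P? letters) ,
    λ pd → All.lookup (f[argmin]≤f[xs] c candidates) (∈-candidates pd)

block-~⇒<total : x ~ block r ∷ x′ → r < total x
block-~⇒<total (eq , _) = ≤-trans (s≤s (m≤m+n _ _)) (≤-reflexive (sym eq))

Push⇒~ : Push l x x′ → x ~ l ∷ x′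
Push⇒~ p = ~-sym (⊑⇒~ (Push⇒⊑ p))

size : Word m → ℕ
size x = total x + length (lights x)

~⇒size≡ : x ~ y → size x ≡ size y
~⇒size≡ (eq , σ) = cong₂ _+_ eq (↭-length σ)

size-∷ : ∀ l (x : Word m) → size x < size (l ∷ x)
size-∷ (light i) x = ≤-reflexive (sym (+-suc (total x) _))
size-∷ (block r) x = s≤s (+-monoˡ-≤ _ (m≤n+m _ r))

empty : total x ≡ 0 → lights x ≡ [] → x ≡ []
empty {x = []}          _  _  = refl
empty {x = light _ ∷ _} _  ()
empty {x = block _ ∷ _} () _

lights-≡[] : x ~ y → lights x ≡ [] → lights y ≡ []
lights-≡[] (_ , σ) eq = ↭-empty-inv (↭-sym (subst (_↭ _) eq σ))

-- Letters common to two words.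

least-light : (is : List (Fin m)) → is ≡ [] ⊎ ∃[ i ] i ∈ is × All (λ j → toℕ i ≤ toℕ j) is
least-light []       = inj₁ refl
least-light (i ∷ is) = inj₂ (_ , argmin-all toℕ (here refl) (All.tabulate there) ,
  f[argmin]≤f[⊤] {f = toℕ} i is ∷ f[argmin]≤f[xs] i is)

greatest-light : (is : List (Fin m)) → is ≡ [] ⊎ ∃[ i ] i ∈ is × All (λ j → toℕ j ≤ toℕ i) is
greatest-light []       = inj₁ refl
greatest-light (i ∷ is) = inj₂ (_ , argmax-all toℕ (here refl) (All.tabulate there) ,
  f[⊥]≤f[argmax] {f = toℕ} i is ∷ f[xs]≤f[argmax] i is)

pull-least : i ∈ lights x → All (λ j → toℕ i ≤ toℕ j) (lights x) → ∃ (Pull (light i) x)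
pull-least {x = block r ∷ x} i∈x         i≤x = _ , past light≺block (proj₂ (pull-least i∈x i≤x))
pull-least {x = light j ∷ x} (here refl) _   = _ , here
pull-least {i = i} {x = light j ∷ x} (there i∈x) (i≤j ∷ i≤x) with compare-≼ (light i) (light j) i≤j
... | inj₁ refl = _ , here
... | inj₂ i≺j  = _ , past i≺j (proj₂ (pull-least i∈x i≤x))

-- A light cannot be pushed out from below a block, so the word must consist of lights only.
push-greatest : total x ≡ 0 → i ∈ lights x → All (λ j → toℕ j ≤ toℕ i) (lights x) → ∃ (Push (light i) x)
push-greatest {x = light j ∷ x} _   (here refl) _ = _ , here
push-greatest {x = light j ∷ x} {i = i} x≡0 (there i∈x) (j≤i ∷ x≤i) with compare-≼ (light j) (light i) j≤i
... | inj₁ refl = _ , here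
... | inj₂ j≺i  = _ , past j≺i (proj₂ (push-greatest x≡0 i∈x x≤i))

-- All blocks are merged into one, which moves above every light; the result depends on the total
-- alone and so is common to related words.
push-total : total x ≡ suc t → ∃ (Push (block t) x)
push-total {x = light i ∷ x} eq = _ , past light≺block (proj₂ (push-total eq))
push-total {x = block r ∷ x} eq with total x in x-total
... | zero  with refl ← trans (suc-injective (sym eq)) (+-identityʳ r) = _ , here
... | suc u = _ , join (trans (suc-injective (sym eq)) (+-suc r u)) (proj₂ (push-total x-total))

pull-unit : ∀ r → ∃ (Pull (block 0) (block r ∷ x))
pull-unit zero    = _ , here
pull-unit (suc r) = _ , part refl

common-unit : total x ≡ total y → lights x ≡ [] → lights y ≡ [] →
              (x ≡ [] × y ≡ []) ⊎ ∃[ c ] ∃ (Pull c x) × ∃ (Pull c y)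
common-unit {x = []}          {y = []}          _  _  _  = inj₁ (refl , refl)
common-unit {x = block r ∷ _} {y = block s ∷ _} _  _  _  = inj₂ (block 0 , pull-unit r , pull-unit s)
common-unit {x = []}          {y = block _ ∷ _} () _  _
common-unit {x = block _ ∷ _} {y = []}          () _  _
common-unit {x = light _ ∷ _}                   _  () _
common-unit                   {y = light _ ∷ _} _  _  ()

-- The least light can be pulled from any depth. Without lights, nonempty words begin with blocks,
-- and every block yields its first unit `block 0`.
common-pull : x ~ y → (x ≡ [] × y ≡ []) ⊎ ∃[ c ] ∃ (Pull c x) × ∃ (Pull c y)
common-pull {x = x} x~y with least-light (lights x)
... | inj₂ (i , i∈x , i≤x) =
  inj₂ (light i , pull-least i∈x i≤x ,
        pull-least (∈-resp-↭ (lights-↭ x~y) i∈x) (All-resp-↭ (lights-↭ x~y) i≤x))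
... | inj₁ no-lights = common-unit (total-≡ x~y) no-lights (lights-≡[] x~y no-lights)

common-push : x ~ y → (x ≡ [] × y ≡ []) ⊎ ∃[ c ] ∃ (Push c x) × ∃ (Push c y)
common-push {x = x} x~y with total x in x-total
... | suc t = inj₂ (block t , push-total x-total , push-total (trans (sym (total-≡ x~y)) x-total))
... | zero with greatest-light (lights x)
...   | inj₂ (i , i∈x , x≤i) =
  inj₂ (light i , push-greatest x-total i∈x x≤i ,
        push-greatest (trans (sym (total-≡ x~y)) x-total) (∈-resp-↭ (lights-↭ x~y) i∈x) (All-resp-↭ (lights-↭ x~y) x≤i))
...   | inj₁ no-lights = inj₁ (empty x-total no-lights , empty (trans (sym (total-≡ x~y)) x-total) (lights-≡[] x~y no-lights))

∃-Join : Acc _<_ (size x) → x ~ y → ∃ (Join x y)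
∃-Join {x = x} {y} (acc rec) x~y with common-pull x~y
... | inj₁ (refl , refl) = _ , []
... | inj₂ (c , px , py)
  with l , ((x′ , p) , (y′ , q)) , l-max ←
         ∃-greatest (λ c → ∃ (Pull c x) × ∃ (Pull c y)) (λ c → pull? c x ×-dec pull? c y)
                    (λ ((_ , p) , _) → block-~⇒<total (Pull⇒~ p)) (px , py) =
  let x~l∷x′ = Pull⇒~ p
      x′~y′  = ∷-cancel-~ (~-trans (~-sym x~l∷x′) (~-trans x~y (Pull⇒~ q)))
      smaller = ≤-trans (size-∷ l x′) (≤-reflexive (sym (~⇒size≡ x~l∷x′)))
      _ , J  = ∃-Join (rec smaller) x′~y′
  in _ , cons p q (λ a b → l-max ((_ , a) , (_ , b))) J

∃-Meet : Acc _<_ (size x) → x ~ y → ∃ (Meet x y)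
∃-Meet {x = x} {y} (acc rec) x~y with common-push x~y
... | inj₁ (refl , refl) = _ , []
... | inj₂ (c , px , py)
  with l , ((x′ , p) , (y′ , q)) , l-min ←
         ∃-least (λ c → ∃ (Push c x) × ∃ (Push c y)) (λ c → push? c x ×-dec push? c y)
                 (λ ((_ , p) , _) → block-~⇒<total (Push⇒~ p)) (px , py) =
  let x~l∷x′ = Push⇒~ p
      x′~y′  = ∷-cancel-~ (~-trans (~-sym x~l∷x′) (~-trans x~y (Push⇒~ q)))
      smaller = ≤-trans (size-∷ l x′) (≤-reflexive (sym (~⇒size≡ x~l∷x′)))
      _ , M  = ∃-Meet (rec smaller) x′~y′
  in _ , cons p q (λ a b → l-min ((_ , a) , (_ , b))) M

-- Words and unary shades

embed : Letter m → Layer m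
embed (light i) = cut i
embed (block r) = single (suc r)

-- The cases returning [] do not occur on unary shades.
decodeLayer : Layer m → Word m
decodeLayer ([] , p) with nonempty? p
... | yes (i , _) = light i ∷ []
... | no _        = []
decodeLayer (zero  ∷ _ , _) = []
decodeLayer (suc r ∷ _ , _) = block r ∷ []

decode : List (Layer m) → Word m
decode = concatMap decodeLayer

decodeLayer-embed : ∀ (l : Letter m) → decodeLayer (embed l) ≡ l ∷ []
decodeLayer-embed (block r) = refl
decodeLayer-embed (light i) with nonempty? ⁅ i ⁆
... | yes (j , j∈⁅i⁆) = cong (λ k → light k ∷ []) (x∈⁅y⁆⇒x≡y i j∈⁅i⁆)
... | no  empty       = contradiction (i , x∈⁅x⁆ i) empty

decode-embed : ∀ (x : Word m) → decode (map embed x) ≡ x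
decode-embed []      = refl
decode-embed (l ∷ x) = cong₂ _++_ (decodeLayer-embed l) (decode-embed x)

embed-injective : ∀ {x y : Word m} → map embed x ≡ map embed y → x ≡ y
embed-injective eq = trans (sym (decode-embed _)) (trans (cong decode eq) (decode-embed _))

embed-decode : ∀ {S : List (Layer m)} → All (All (1 ≤_) ∘ tuple) S → IsUnary S → map embed (decode S) ≡ S
embed-decode []                       []                      = refl
embed-decode (_ ∷ ps)                 (inj₁ (i , refl) ∷ us)
  rewrite decodeLayer-embed (light i)                         = cong (cut i ∷_) (embed-decode ps us)
embed-decode ((s≤s {n = r} _ ∷ []) ∷ ps) (inj₂ (_ , refl) ∷ us) = cong (single (suc r) ∷_) (embed-decode ps us)

⇝⇒⟶ : x ⇝ y → map embed x ⟶ map embed y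
⇝⇒⟶ (split {s = s} {t} refl)  = split z<s z<s (cong suc (sym (+-suc s t)))
⇝⇒⟶ (lift {l = light _} i≺l)  = swap i≺l
⇝⇒⟶ (lift {l = block _} i≺l)  = raise
⇝⇒⟶ (below x⇝y)               = below (⇝⇒⟶ x⇝y)

embed-cut : cut i ≡ embed l → l ≡ light i
embed-cut {i = i} {l = l} eq = ∷-injectiveˡ (trans (sym (decodeLayer-embed l)) (trans (cong decodeLayer (sym eq)) (decodeLayer-embed (light i))))

-- The source is a variable with an equation so that rotations can be matched on; `embed-cut` then
-- recovers the lights by decoding.
⟶⇒⇝ : ∀ x {S T : List (Layer m)} → S ⟶ T → S ≡ map embed x → ∃[ y ] T ≡ map embed y × x ⇝ y
⟶⇒⇝ (block r ∷ x)     (split {s = suc s} {t = suc t} _ _ eq) refl =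
  block s ∷ block t ∷ x , refl , split (trans (suc-injective eq) (+-suc s t))
⟶⇒⇝ (light _ ∷ _)     raise ()
⟶⇒⇝ (block r ∷ k ∷ x) (raise {i = i}) eq
  with refl ← embed-cut {i = i} {l = k} (∷-injectiveˡ (∷-injectiveʳ eq))
  with refl ← eq = light i ∷ block r ∷ x , refl , lift light≺block
⟶⇒⇝ (l ∷ k ∷ x)       (swap {i} {j} i<j) eq
  with refl ← embed-cut {i = j} {l = l} (∷-injectiveˡ eq)
  with refl ← embed-cut {i = i} {l = k} (∷-injectiveˡ (∷-injectiveʳ eq))
  with refl ← eq = light i ∷ light j ∷ x , refl , lift i<j
⟶⇒⇝ (l ∷ x)           (below S⟶T) eq with refl ← ∷-injectiveˡ eq =
  let y , T≡y , x⇝y = ⟶⇒⇝ x S⟶T (∷-injectiveʳ eq) in l ∷ y , cong (embed l ∷_) T≡y , below x⇝y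

-- Words that encode shades.

IsShadeWord : ℕ → Word m → Set
IsShadeWord n x = total x ≡ n × Unique (lights x) × (∀ i → i ∈ lights x)

-- Decidability lets `recompute` recover the condition from the irrelevant proofs stored in a shade.
isShadeWord? : ∀ n (x : Word m) → Dec (IsShadeWord n x)
isShadeWord? n x = total x ≟ n ×-dec unique? Fin._≟_ (lights x) ×-dec Fin.all? (λ i → _∈?_ Fin._≟_ i (lights x))

~-resp-IsShadeWord : x ~ y → IsShadeWord n x → IsShadeWord n y
~-resp-IsShadeWord x~y (x-total , unique , all-lights) =
  trans (sym (total-≡ x~y)) x-total ,
  ↭ₛ.Unique-resp-↭ (setoid _) (↭⇒↭ₛ (lights-↭ x~y)) unique ,
  ∈-resp-↭ (lights-↭ x~y) ∘ all-lights

-- Duplicate-free lists that contain every label are permutations of each other, so joins and meets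
-- exist for any two shades.
IsShadeWord⇒~ : IsShadeWord n x → IsShadeWord n y → x ~ y
IsShadeWord⇒~ (x-total , x-unique , x-all) (y-total , y-unique , y-all) =
  trans x-total (sym y-total) ,
  ∼bag⇒↭ (unique∧set⇒bag x-unique y-unique (mk⇔ (λ _ → y-all _) (λ _ → x-all _)))

sum-embed : ∀ (x : Word m) → sum (map (sum ∘ tuple) (map embed x)) ≡ total x
sum-embed []            = refl
sum-embed (light i ∷ x) = sum-embed x
sum-embed (block r ∷ x) = cong₂ (λ a b → suc (a + b)) (+-identityʳ r) (sum-embed x)

∈-labels⁺ : ∀ (x : Word m) → i ∈ lights x → i Subset.∈ ⋃ (map labels (map embed x))
∈-labels⁺ (light i ∷ x) (here refl) = x∈p∪q⁺ (inj₁ (x∈⁅x⁆ i))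
∈-labels⁺ (light i ∷ x) (there i∈x) = x∈p∪q⁺ (inj₂ (∈-labels⁺ x i∈x))
∈-labels⁺ (block r ∷ x) i∈x         = x∈p∪q⁺ (inj₂ (∈-labels⁺ x i∈x))

∈-labels⁻ : ∀ (x : Word m) → i Subset.∈ ⋃ (map labels (map embed x)) → i ∈ lights x
∈-labels⁻ []      i∈⊥ = contradiction i∈⊥ ∉⊥
∈-labels⁻ (l ∷ x) i∈  with x∈p∪q⁻ (labels (embed l)) _ i∈
∈-labels⁻ (light i ∷ x) _ | inj₁ i∈⁅i⁆ = here (x∈⁅y⁆⇒x≡y i i∈⁅i⁆)
∈-labels⁻ (light i ∷ x) _ | inj₂ i∈x   = there (∈-labels⁻ x i∈x)
∈-labels⁻ (block r ∷ x) _ | inj₁ i∈⊥   = contradiction i∈⊥ ∉⊥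
∈-labels⁻ (block r ∷ x) _ | inj₂ i∈x   = ∈-labels⁻ x i∈x

⊥-disjointˡ : ∀ {p : Subset m} → Empty (⊥ ∩ p)
⊥-disjointˡ (_ , i∈) = ∉⊥ (proj₁ (x∈p∩q⁻ ⊥ _ i∈))

⊥-disjointʳ : ∀ {p : Subset m} → Empty (p ∩ ⊥)
⊥-disjointʳ (_ , i∈) = ∉⊥ (proj₂ (x∈p∩q⁻ _ ⊥ i∈))

⁅⁆-disjoint : i ≢ j → Empty (⁅ i ⁆ ∩ ⁅ j ⁆)
⁅⁆-disjoint {i = i} {j} i≢j (_ , k∈) =
  let k∈⁅i⁆ , k∈⁅j⁆ = x∈p∩q⁻ ⁅ i ⁆ ⁅ j ⁆ k∈
  in i≢j (trans (sym (x∈⁅y⁆⇒x≡y i k∈⁅i⁆)) (x∈⁅y⁆⇒x≡y j k∈⁅j⁆))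

fresh⇒disjoint : ∀ (x : Word m) → All (i ≢_) (lights x) → All (λ l → Empty (⁅ i ⁆ ∩ labels l)) (map embed x)
fresh⇒disjoint []            _            = []
fresh⇒disjoint (light j ∷ x) (i≢j ∷ i∉x) = ⁅⁆-disjoint i≢j ∷ fresh⇒disjoint x i∉x
fresh⇒disjoint (block r ∷ x) i∉x         = ⊥-disjointʳ ∷ fresh⇒disjoint x i∉x

disjoint⇒fresh : ∀ (x : Word m) → All (λ l → Empty (⁅ i ⁆ ∩ labels l)) (map embed x) → All (i ≢_) (lights x)
disjoint⇒fresh []            []       = []
disjoint⇒fresh (light j ∷ x) (e ∷ es) = (λ { refl → e (j , x∈p∩q⁺ (x∈⁅x⁆ j , x∈⁅x⁆ j)) }) ∷ disjoint⇒fresh x es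
disjoint⇒fresh (block r ∷ x) (_ ∷ es) = disjoint⇒fresh x es

unique⇒disjoint : ∀ (x : Word m) → Unique (lights x) → AllPairs (λ l l′ → Empty (labels l ∩ labels l′)) (map embed x)
unique⇒disjoint []            _         = []
unique⇒disjoint (light i ∷ x) (i∉x ∷ u) = fresh⇒disjoint x i∉x ∷ unique⇒disjoint x u
unique⇒disjoint (block r ∷ x) u         = All.universal (λ _ → ⊥-disjointˡ) _ ∷ unique⇒disjoint x u

disjoint⇒unique : ∀ (x : Word m) → AllPairs (λ l l′ → Empty (labels l ∩ labels l′)) (map embed x) → Unique (lights x)
disjoint⇒unique []            []       = []
disjoint⇒unique (light i ∷ x) (d ∷ ds) = disjoint⇒fresh x d ∷ disjoint⇒unique x ds
disjoint⇒unique (block r ∷ x) (_ ∷ ds) = disjoint⇒unique x ds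

IsShadeWord⇒IsShade : IsShadeWord n x → IsShade m n (map embed x)
IsShadeWord⇒IsShade {x = x} (x-total , unique , all-lights) = record
  { positive = map⁺ (All.universal (λ { (light _) → [] ; (block _) → z<s ∷ [] }) x)
  ; total    = trans (sum-embed x) x-total
  ; disjoint = unique⇒disjoint x unique
  ; covering = ⊆-antisym ⊆⊤ (λ {i} _ → ∈-labels⁺ x (all-lights i))
  ; nonempty = map⁺ (All.universal (λ { (light i) _ → i , x∈⁅x⁆ i ; (block _) () }) x)
  }

IsShade⇒IsShadeWord : ∀ (x : Word m) → IsShade m n (map embed x) → IsShadeWord n x
IsShade⇒IsShadeWord x S =
  trans (sym (sum-embed x)) (IsShade.total S) ,
  disjoint⇒unique x (IsShade.disjoint S) ,
  λ i → ∈-labels⁻ x (subst (i Subset.∈_) (sym (IsShade.covering S)) ∈⊤)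

embed-isUnary : ∀ (x : Word m) → IsUnary (map embed x)
embed-isUnary x = map⁺ (All.universal (λ { (light i) → inj₁ (i , refl) ; (block r) → inj₂ (suc r , refl) }) x)

shade : (x : Word m) → .(IsShadeWord n x) → UnaryShade m n
shade x v = (map embed x , [ IsShadeWord⇒IsShade v ]) , [ embed-isUnary x ]

word : UnaryShade m n → Word m
word = decode ∘ layers

embed-word : (S : UnaryShade m n) → map embed (word S) ≡ layers S
embed-word ((_ , [ S ]) , [ U ]) = recompute (List.≡-dec (Product.≡-dec (List.≡-dec _≟_) (Vec.≡-dec Bool._≟_)) _ _)
  (embed-decode (IsShade.positive S) U)

word-injective : ∀ {S T : UnaryShade m n} → word S ≡ word T → S ≡ T
word-injective {S = S} {T} eq = value-injective (value-injective
  (trans (sym (embed-word S)) (trans (cong (map embed) eq) (embed-word T))))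

word-isShadeWord : (S : UnaryShade m n) → IsShadeWord n (word S)
word-isShadeWord S@((_ , [ S′ ]) , _) = recompute (isShadeWord? _ (word S))
  (IsShade⇒IsShadeWord (word S) (subst (IsShade _ _) (sym (embed-word S)) S′))

word-~ : (S T : UnaryShade m n) → word S ~ word T
word-~ S T = IsShadeWord⇒~ (word-isShadeWord S) (word-isShadeWord T)

shade-~ : (S : UnaryShade m n) → word S ~ x → UnaryShade m n
shade-~ {x = x} S S~x = shade x (~-resp-IsShadeWord S~x (word-isShadeWord S))

-- The lattice of unary shades.

_≼_ : Rel (UnaryShade m n) _
S ≼ T = word S ⊑ word T

joinWord : (S T : UnaryShade m n) → ∃ (Join (word S) (word T))
joinWord S T = ∃-Join (<-wellFounded _) (word-~ S T)

meetWord : (S T : UnaryShade m n) → ∃ (Meet (word S) (word T))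
meetWord S T = ∃-Meet (<-wellFounded _) (word-~ S T)

_∨_ _∧_ : Op₂ (UnaryShade m n)
S ∨ T = shade-~ S (⊑⇒~ (Join⇒⊑ˡ (proj₂ (joinWord S T))))
S ∧ T = shade-~ S (~-sym (⊑⇒~ (Meet⇒⊑ˡ (proj₂ (meetWord S T)))))

≼-isLattice : IsLattice {A = UnaryShade m n} _≡_ _≼_ _∨_ _∧_
≼-isLattice = record
  { isPartialOrder = record
    { isPreorder = record
      { isEquivalence = isEquivalence
      ; reflexive     = λ { {S} refl → ⊑-refl {x = word S} }
      ; trans         = ⊑-trans
      }
    ; antisym = λ S≼T T≼S → word-injective (⊑-antisym S≼T T≼S)
    }
  ; supremum = λ S T → let z , J = joinWord S T in
      subst (word S ⊑_) (sym (decode-embed z)) (Join⇒⊑ˡ J) ,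
      subst (word T ⊑_) (sym (decode-embed z)) (Join⇒⊑ʳ J) ,
      λ U S≼U T≼U → subst (_⊑ word U) (sym (decode-embed z)) (Join-least J S≼U T≼U)
  ; infimum  = λ S T → let z , M = meetWord S T in
      subst (_⊑ word S) (sym (decode-embed z)) (Meet⇒⊑ˡ M) ,
      subst (_⊑ word T) (sym (decode-embed z)) (Meet⇒⊑ʳ M) ,
      λ U U≼S U≼T → subst (word U ⊑_) (sym (decode-embed z)) (Meet-greatest M U≼S U≼T)
  }

-- Rotations are the covers of the lattice.

rotation⇒⇝ : ∀ {S T : UnaryShade m n} → RightRotation m n S T → word S ⇝ word T
rotation⇒⇝ {S = S} {T} S⟶T =
  let y , T≡y , S⇝y = ⟶⇒⇝ (word S) S⟶T (sym (embed-word S))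
  in subst (word S ⇝_) (embed-injective (trans (sym T≡y) (sym (embed-word T)))) S⇝y

⇝⇒rotation : ∀ {S T : UnaryShade m n} → word S ⇝ word T → RightRotation m n S T
⇝⇒rotation {S = S} {T} S⇝T = subst₂ _⟶_ (embed-word S) (embed-word T) (⇝⇒⟶ S⇝T)

⇝⇒covers : ∀ {S T : UnaryShade m n} → word S ⇝ word T → Covers _≡_ _≼_ S T
⇝⇒covers {S = S} {T} S⇝T =
  (⇝⇒⊑ S⇝T , λ { refl → ⇝-irrefl S⇝T }) ,
  λ (U , (S≼U , S≢U) , (U≼T , U≢T)) → case ⇝-between S⇝T S≼U U≼T of λ where
    (inj₁ U≡S) → S≢U (word-injective (sym U≡S))
    (inj₂ U≡T) → U≢T (word-injective U≡T)

covers⇒⇝ : ∀ {S T : UnaryShade m n} → Covers _≡_ _≼_ S T → word S ⇝ word T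
covers⇒⇝ {S = S} {T} ((S≼T , S≢T) , nothing-between) with ⊑⇒⇝ S≼T
... | inj₁ S≡T = contradiction (word-injective S≡T) S≢T
... | inj₂ (z , S⇝z , z⊑T) with ⊑⇒⇝ z⊑T
...   | inj₁ refl = S⇝z
-- A second step is needed after `z`, so the shade of `z` lies strictly between `S` and `T`.
...   | inj₂ (w , z⇝w , w⊑T) = contradiction (Z , S<Z , Z<T) nothing-between
  where
  Z = shade-~ S (⇝⇒~ S⇝z)

  Z≡z : word Z ≡ z
  Z≡z = decode-embed z

  S<Z : S ≼ Z × S ≢ Z
  S<Z = subst (word S ⊑_) (sym Z≡z) (⇝⇒⊑ S⇝z) ,
        λ S≡Z → ⇝-irrefl (subst (word S ⇝_) (trans (sym Z≡z) (cong word (sym S≡Z))) S⇝z)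

  Z<T : Z ≼ T × Z ≢ T
  Z<T = subst (_⊑ word T) (sym Z≡z) z⊑T ,
        -- If `Z` were `T`, then `w ⊑ z` as well as `z ⊑ w`, and the step `z ⇝ w` would be a loop.
        λ Z≡T → ⇝-irrefl (subst (z ⇝_) (⊑-antisym
          (subst (_ ⊑_) (trans (cong word (sym Z≡T)) Z≡z) w⊑T) (⇝⇒⊑ z⇝w)) z⇝w)

proposition27 : (m n : ℕ) → IsHasseDiagramOfLattice (RightRotation m n)
proposition27 m n = _≼_ {m} {n} , _∨_ , _∧_ , ≼-isLattice ,
  λ S T → mk⇔ (λ S⟶T → ⇝⇒covers {S = S} {T} (rotation⇒⇝ {S = S} {T} S⟶T))
              (λ S⋖T → ⇝⇒rotation {S = S} {T} (covers⇒⇝ {S = S} {T} S⋖T))
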